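{- Let $n \ge 1$, $1 \le k \le n$, and $U \in \{\pm X, \pm Y, \pm Z\}$, and let $U_k = I^{\otimes (k-1)} \otimes U \otimes I^{\otimes (n-k)}$, acting on $(\mathbb{C}^2)^{\otimes n}$. Then every state of type $U_k$, i.e. every eigenstate of $U_k$, is separable in the sense that the $k$-th tensor factor (the one associated with $U$) is unentangled with the rest of the system.
   Context: $X = \begin{pmatrix}0&1\\1&0\end{pmatrix}$, $Y = \begin{pmatrix}0&-i\\i&0\end{pmatrix}$, $Z = \begin{pmatrix}1&0\\0&-1\end{pmatrix}$ are the Pauli matrices and $I$ is the $2\times 2$ identity matrix. An $n$-qubit state (nonzero vector in $(\mathbb{C}^2)^{\otimes n}$) has type $A$, for $A$ an operator on $(\mathbb{C}^2)^{\otimes n}$, if it is an eigenstate of $A$, i.e. $A|\phi\rangle = \lambda|\phi\rangle$ for some $\lambda \in \mathbb{C}$. The $k$-th factor of a state $|\phi\rangle$ is unentangled with the rest of the system if, under the canonical identification $(\mathbb{C}^2)^{\otimes n} \cong \mathbb{C}^2 \otimes (\mathbb{C}^2)^{\otimes (n-1)}$ that moves the $k$-th factor to the front and keeps the order of the others, $|\phi\rangle$ is a pure tensor $|u\rangle \otimes |\psi\rangle$ with $|u\rangle \in \mathbb{C}^2$ and $|\psi\rangle \in (\mathbb{C}^2)^{\otimes (n-1)}$ (where $(\mathbb{C}^2)^{\otimes 0} = \mathbb{C}$). -}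

module Defs where

open import Data.Fin.Base using (Fin)
open import Data.Fin.Patterns using (0F; 1F)
open import Data.List.Base as List using (List)
open import Data.Nat.Base using (ℕ; zero; suc; _≥_; _⊔_)
import Data.Nat.Properties as ℕ
open import Data.Product.Base using (_×_; _,_; proj₁; proj₂; ∃-syntax)
open import Data.Rational.Base as ℚ using (ℚ; 0ℚ; 1ℚ; ½; ∣_∣; 1/_; Positive; positive)
import Data.Rational.Properties as ℚ
open import Data.Rational.Solver using (module +-*-Solver)
open import Data.Vec.Base using (Vec; []; _∷_; lookup; insertAt; replicate; _[_]≔_)
open import Relation.Binary.PropositionalEquality using (_≡_; refl; sym; trans; cong; subst)
open import Relation.Nullary.Negation.Core using (¬_)

open +-*-Solver using (solve; _:=_; _:+_; _:*_; _:-_; :-_; con)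

-- Real numbers: Cauchy sequences of rationals, compared up to null
-- sequences. _≃_ and the relations derived from it play the role of
-- equality.

IsCauchy : (ℕ → ℚ) → Set
IsCauchy x =
  ∀ ε → 0ℚ ℚ.< ε → ∃[ N ] (∀ m n → m ≥ N → n ≥ N → ∣ x m ℚ.- x n ∣ ℚ.< ε)

record ℝ : Set where
  constructor _,_
  field
    seq      : ℕ → ℚ
    isCauchy : IsCauchy seq

open ℝ public

infix 4 _≃_

_≃_ : ℝ → ℝ → Set
x ≃ y = ∀ ε → 0ℚ ℚ.< ε → ∃[ N ] (∀ n → n ≥ N → ∣ seq x n ℚ.- seq y n ∣ ℚ.< ε)

half-pos : ∀ {ε} → 0ℚ ℚ.< ε → 0ℚ ℚ.< ½ ℚ.* ε
half-pos = ℚ.*-monoʳ-<-pos ½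

halves : ∀ ε → ½ ℚ.* ε ℚ.+ ½ ℚ.* ε ≡ ε
halves = solve 1 (λ ε → con ½ :* ε :+ con ½ :* ε := ε) refl

m⊔n≤o⇒m≤o : ∀ {m n o} → o ≥ m ⊔ n → o ≥ m
m⊔n≤o⇒m≤o {m} {n} = ℕ.m⊔n≤o⇒m≤o m n

m⊔n≤o⇒n≤o : ∀ {m n o} → o ≥ m ⊔ n → o ≥ n
m⊔n≤o⇒n≤o {m} {n} = ℕ.m⊔n≤o⇒n≤o m n

open ℚ.≤-Reasoning

const-cauchy : ∀ q → IsCauchy (λ _ → q)
const-cauchy q ε ε>0 =
  0 , λ _ _ _ _ → subst (ℚ._< ε) (sym (cong ∣_∣ (ℚ.+-inverseʳ q))) ε>0

neg-cauchy : ∀ {x} → IsCauchy x → IsCauchy (λ n → ℚ.- x n)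
neg-cauchy {x} cx ε ε>0 with cx ε ε>0
... | N , h = N , λ m n m≥N n≥N → subst (ℚ._< ε) (sym (eq (x m) (x n))) (h m n m≥N n≥N)
  where
  eq : ∀ a b → ∣ ℚ.- a ℚ.- ℚ.- b ∣ ≡ ∣ a ℚ.- b ∣
  eq a b = trans
    (cong ∣_∣ (solve 2 (λ a b → :- a :- :- b := :- (a :- b)) refl a b))
    (ℚ.∣-p∣≡∣p∣ (a ℚ.- b))

+-cauchy : ∀ {x y} → IsCauchy x → IsCauchy y → IsCauchy (λ n → x n ℚ.+ y n)
+-cauchy {x} {y} cx cy ε ε>0
  with cx _ (half-pos ε>0) | cy _ (half-pos ε>0)
... | N₁ , h₁ | N₂ , h₂ = N₁ ⊔ N₂ , λ m n m≥N n≥N → begin-strict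
  ∣ (x m ℚ.+ y m) ℚ.- (x n ℚ.+ y n) ∣
    ≡⟨ cong ∣_∣ (solve 4 (λ a b c d → (a :+ b) :- (c :+ d) := (a :- c) :+ (b :- d))
         refl (x m) (y m) (x n) (y n)) ⟩
  ∣ (x m ℚ.- x n) ℚ.+ (y m ℚ.- y n) ∣
    ≤⟨ ℚ.∣p+q∣≤∣p∣+∣q∣ (x m ℚ.- x n) (y m ℚ.- y n) ⟩
  ∣ x m ℚ.- x n ∣ ℚ.+ ∣ y m ℚ.- y n ∣
    <⟨ ℚ.+-mono-< (h₁ m n (m⊔n≤o⇒m≤o m≥N) (m⊔n≤o⇒m≤o n≥N))
                  (h₂ m n (m⊔n≤o⇒n≤o m≥N) (m⊔n≤o⇒n≤o n≥N)) ⟩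
  ½ ℚ.* ε ℚ.+ ½ ℚ.* ε
    ≡⟨ halves ε ⟩
  ε ∎

eventually-bounded : ∀ {x} → IsCauchy x →
  ∃[ B ] (0ℚ ℚ.< B × ∃[ N ] (∀ n → n ≥ N → ∣ x n ∣ ℚ.≤ B))
eventually-bounded {x} cx with cx 1ℚ (ℚ.positive⁻¹ 1ℚ)
... | N , h =
  1ℚ ℚ.+ ∣ x N ∣ ,
  ℚ.+-mono-<-≤ (ℚ.positive⁻¹ 1ℚ) (ℚ.0≤∣p∣ (x N)) ,
  N , λ n n≥N → begin
    ∣ x n ∣
      ≡⟨ cong ∣_∣ (solve 2 (λ a b → a := (a :- b) :+ b) refl (x n) (x N)) ⟩
    ∣ (x n ℚ.- x N) ℚ.+ x N ∣
      ≤⟨ ℚ.∣p+q∣≤∣p∣+∣q∣ (x n ℚ.- x N) (x N) ⟩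
    ∣ x n ℚ.- x N ∣ ℚ.+ ∣ x N ∣
      ≤⟨ ℚ.+-monoˡ-≤ ∣ x N ∣ (ℚ.<⇒≤ (h n N n≥N ℕ.≤-refl)) ⟩
    1ℚ ℚ.+ ∣ x N ∣ ∎

∣p*q∣<B*δ : ∀ {p q B δ} → 0ℚ ℚ.< B → ∣ p ∣ ℚ.≤ B → ∣ q ∣ ℚ.< δ → ∣ p ℚ.* q ∣ ℚ.< B ℚ.* δ
∣p*q∣<B*δ {p} {q} {B} {δ} B>0 p≤B q<δ = begin-strict
  ∣ p ℚ.* q ∣      ≡⟨ ℚ.∣p*q∣≡∣p∣*∣q∣ p q ⟩
  ∣ p ∣ ℚ.* ∣ q ∣  ≤⟨ ℚ.*-monoʳ-≤-nonNeg ∣ q ∣ {{ℚ.nonNegative (ℚ.0≤∣p∣ q)}} p≤B ⟩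
  B ℚ.* ∣ q ∣      <⟨ ℚ.*-monoʳ-<-pos B {{positive B>0}} q<δ ⟩
  B ℚ.* δ          ∎

divide : ∀ {D ε} → 0ℚ ℚ.< D → 0ℚ ℚ.< ε → ∃[ δ ] (0ℚ ℚ.< δ × D ℚ.* δ ≡ ε)
divide {D} {ε} D>0 ε>0 =
  1/ D ℚ.* ε ,
  subst (ℚ._< 1/ D ℚ.* ε) (ℚ.*-zeroʳ (1/ D)) (ℚ.*-monoʳ-<-pos (1/ D) {{ℚ.1/pos⇒pos D}} ε>0) ,
  trans (sym (ℚ.*-assoc D (1/ D) ε))
    (trans (cong (ℚ._* ε) (ℚ.*-inverseʳ D)) (ℚ.*-identityˡ ε))
  where
  instance
    D-pos : Positive D
    D-pos = positive D>0

    D-nonZero : ℚ.NonZero D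
    D-nonZero = ℚ.pos⇒nonZero D

rearrange : ∀ a b c d →
  a ℚ.* b ℚ.- c ℚ.* d ≡ a ℚ.* (b ℚ.- d) ℚ.+ d ℚ.* (a ℚ.- c)
rearrange = solve 4 (λ a b c d → a :* b :- c :* d := a :* (b :- d) :+ d :* (a :- c)) refl

*-cauchy : ∀ {x y} → IsCauchy x → IsCauchy y → IsCauchy (λ n → x n ℚ.* y n)
*-cauchy {x} {y} cx cy ε ε>0 =
  let
    B , B>0 , N₁ , h₁ = eventually-bounded {x} cx
    C , C>0 , N₂ , h₂ = eventually-bounded {y} cy
    δ , δ>0 , eq = divide (ℚ.+-mono-< B>0 C>0) ε>0
    N₃ , h₃ = cx δ δ>0
    N₄ , h₄ = cy δ δ>0
  in (N₁ ⊔ N₂) ⊔ (N₃ ⊔ N₄) , go B C δ N₁ N₂ N₃ N₄ B>0 C>0 eq h₁ h₂ h₃ h₄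
  where
  go : ∀ B C δ N₁ N₂ N₃ N₄ → 0ℚ ℚ.< B → 0ℚ ℚ.< C → (B ℚ.+ C) ℚ.* δ ≡ ε →
       (∀ n → n ≥ N₁ → ∣ x n ∣ ℚ.≤ B) →
       (∀ n → n ≥ N₂ → ∣ y n ∣ ℚ.≤ C) →
       (∀ m n → m ≥ N₃ → n ≥ N₃ → ∣ x m ℚ.- x n ∣ ℚ.< δ) →
       (∀ m n → m ≥ N₄ → n ≥ N₄ → ∣ y m ℚ.- y n ∣ ℚ.< δ) →
       ∀ m n → m ≥ (N₁ ⊔ N₂) ⊔ (N₃ ⊔ N₄) → n ≥ (N₁ ⊔ N₂) ⊔ (N₃ ⊔ N₄) →
       ∣ x m ℚ.* y m ℚ.- x n ℚ.* y n ∣ ℚ.< ε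
  go B C δ N₁ N₂ N₃ N₄ B>0 C>0 [B+C]*δ≡ε h₁ h₂ h₃ h₄ m n m≥N n≥N =
    let
      m≥N₁ = m⊔n≤o⇒m≤o {N₁} {N₂} (m⊔n≤o⇒m≤o m≥N)
      n≥N₂ = m⊔n≤o⇒n≤o {N₁} {N₂} (m⊔n≤o⇒m≤o n≥N)
      m≥N₃ = m⊔n≤o⇒m≤o {N₃} {N₄} (m⊔n≤o⇒n≤o {N₁ ⊔ N₂} m≥N)
      n≥N₃ = m⊔n≤o⇒m≤o {N₃} {N₄} (m⊔n≤o⇒n≤o {N₁ ⊔ N₂} n≥N)
      m≥N₄ = m⊔n≤o⇒n≤o {N₃} {N₄} (m⊔n≤o⇒n≤o {N₁ ⊔ N₂} m≥N)
      n≥N₄ = m⊔n≤o⇒n≤o {N₃} {N₄} (m⊔n≤o⇒n≤o {N₁ ⊔ N₂} n≥N)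
    in begin-strict
    ∣ x m ℚ.* y m ℚ.- x n ℚ.* y n ∣
      ≡⟨ cong ∣_∣ (rearrange (x m) (y m) (x n) (y n)) ⟩
    ∣ x m ℚ.* (y m ℚ.- y n) ℚ.+ y n ℚ.* (x m ℚ.- x n) ∣
      ≤⟨ ℚ.∣p+q∣≤∣p∣+∣q∣ (x m ℚ.* (y m ℚ.- y n)) (y n ℚ.* (x m ℚ.- x n)) ⟩
    ∣ x m ℚ.* (y m ℚ.- y n) ∣ ℚ.+ ∣ y n ℚ.* (x m ℚ.- x n) ∣
      <⟨ ℚ.+-mono-<
           (∣p*q∣<B*δ {x m} {y m ℚ.- y n} B>0 (h₁ m m≥N₁) (h₄ m n m≥N₄ n≥N₄))
           (∣p*q∣<B*δ {y n} {x m ℚ.- x n} C>0 (h₂ n n≥N₂) (h₃ m n m≥N₃ n≥N₃)) ⟩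
    B ℚ.* δ ℚ.+ C ℚ.* δ
      ≡⟨ ℚ.*-distribʳ-+ δ B C ⟨
    (B ℚ.+ C) ℚ.* δ
      ≡⟨ [B+C]*δ≡ε ⟩
    ε ∎

fromℚ : ℚ → ℝ
fromℚ q = (λ _ → q) , const-cauchy q

0ℝ 1ℝ : ℝ
0ℝ = fromℚ 0ℚ
1ℝ = fromℚ 1ℚ

infixl 6 _+ℝ_ _-ℝ_
infixl 7 _*ℝ_
infix  8 -ℝ_

_+ℝ_ : ℝ → ℝ → ℝ
(x , cx) +ℝ (y , cy) = (λ n → x n ℚ.+ y n) , +-cauchy {x} {y} cx cy

-ℝ_ : ℝ → ℝ
-ℝ (x , cx) = (λ n → ℚ.- x n) , neg-cauchy {x} cx

_*ℝ_ : ℝ → ℝ → ℝ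
(x , cx) *ℝ (y , cy) = (λ n → x n ℚ.* y n) , *-cauchy {x} {y} cx cy

_-ℝ_ : ℝ → ℝ → ℝ
x -ℝ y = x +ℝ -ℝ y

record ℂ : Set where
  constructor _+i_
  field
    re im : ℝ

open ℂ public

infix  4 _≈_
infixl 6 _+_
infixl 7 _*_
infix  8 -_

_≈_ : ℂ → ℂ → Set
z ≈ w = re z ≃ re w × im z ≃ im w

0ℂ 1ℂ iℂ : ℂ
0ℂ = 0ℝ +i 0ℝ
1ℂ = 1ℝ +i 0ℝ
iℂ = 0ℝ +i 1ℝ

_+_ : ℂ → ℂ → ℂ
(a +i b) + (c +i d) = (a +ℝ c) +i (b +ℝ d)

-_ : ℂ → ℂ
- (a +i b) = (-ℝ a) +i (-ℝ b)

_*_ : ℂ → ℂ → ℂ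
(a +i b) * (c +i d) = (a *ℝ c -ℝ b *ℝ d) +i (a *ℝ d +ℝ b *ℝ c)

-- Vectors and operators in coordinates: `Vector ι` is the complex vector
-- space with basis ι, and `Operator ι` consists of the matrices (row index
-- first) in that basis.

Vector : Set → Set
Vector ι = ι → ℂ

Operator : Set → Set
Operator ι = ι → ι → ℂ

infix 4 _≋_

_≋_ : ∀ {ι} → Vector ι → Vector ι → Set
v ≋ w = ∀ i → v i ≈ w i

Nonzero : ∀ {ι} → Vector ι → Set
Nonzero v = ¬ (v ≋ λ _ → 0ℂ)

infixr 7 _·_ _⊗_

_·_ : ∀ {ι} → ℂ → Vector ι → Vector ι
(c · v) i = c * v i

_⊗_ : ∀ {ι κ} → Vector ι → Vector κ → Vector (ι × κ)
(v ⊗ w) (i , j) = v i * w j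

-- The n-fold tensor power of ℂ². Its computational basis is indexed by bit
-- strings, x₁ ∷ … ∷ xₙ ∷ [] standing for e_{x₁} ⊗ … ⊗ e_{xₙ}.

Bits : ℕ → Set
Bits = Vec (Fin 2)

∑ : ∀ {n} → (Bits n → ℂ) → ℂ
∑ {zero}  f = f []
∑ {suc n} f = ∑ (λ x → f (0F ∷ x)) + ∑ (λ x → f (1F ∷ x))

infixr 7 _$$_

_$$_ : ∀ {n} → Operator (Bits n) → Vector (Bits n) → Vector (Bits n)
(A $$ v) x = ∑ (λ y → A x y * v y)

⨂ : ∀ {n} → Vec (Operator (Fin 2)) n → Operator (Bits n)
⨂ []       []      []      = 1ℂ
⨂ (M ∷ Ms) (i ∷ x) (j ∷ y) = M i j * ⨂ Ms x y

matrix : Vec (Vec ℂ 2) 2 → Operator (Fin 2)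
matrix rows i j = lookup (lookup rows i) j

I X Y Z : Operator (Fin 2)
I = matrix ((1ℂ ∷ 0ℂ ∷ []) ∷
            (0ℂ ∷ 1ℂ ∷ []) ∷ [])
X = matrix ((0ℂ ∷ 1ℂ ∷ []) ∷
            (1ℂ ∷ 0ℂ ∷ []) ∷ [])
Y = matrix ((0ℂ ∷ - iℂ ∷ []) ∷
            (iℂ ∷ 0ℂ   ∷ []) ∷ [])
Z = matrix ((1ℂ ∷ 0ℂ   ∷ []) ∷
            (0ℂ ∷ - 1ℂ ∷ []) ∷ [])

neg : ∀ {ι} → Operator ι → Operator ι
neg A i j = - A i j

±Paulis : List (Operator (Fin 2))
±Paulis = X List.∷ neg X List.∷ Y List.∷ neg Y List.∷ Z List.∷ neg Z List.∷ List.[]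

-- U acts on factor k, counted from 0

infix 8 _at_

_at_ : ∀ {n} → Operator (Fin 2) → Fin n → Operator (Bits n)
U at k = ⨂ (replicate _ I [ k ]≔ U)

record State (n : ℕ) : Set where
  constructor _,_
  field
    vector  : Vector (Bits n)
    nonzero : Nonzero vector

open State public

HasType : ∀ {n} → Operator (Bits n) → State n → Set
HasType A φ = ∃[ c ] (A $$ vector φ ≋ c · vector φ)

-- The canonical map (ℂ²)^{⊗(n+1)} ≅ ℂ² ⊗ (ℂ²)^{⊗n} moving factor k to the
-- front, which sends e_{insertAt x k b} to e_b ⊗ e_x.

toFront : ∀ {n} → Fin (suc n) → Vector (Bits (suc n)) → Vector (Fin 2 × Bits n)
toFront k v (b , x) = v (insertAt x k b)

Unentangled : ∀ {n} → Fin (suc n) → State (suc n) → Set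
Unentangled {n} k φ =
  ∃[ u ] ∃[ ψ ] (toFront {n} k (vector φ) ≋ u ⊗ ψ)

{-# OPTIONS --safe #-}

-- Write a and b for the slices of the state along bit k = 0 and k = 1. Row by
-- row, the eigenvalue equation says U (a, b) = c (a, b). If U is antidiagonal,
-- its first row expresses b as a multiple of a. If U is diagonal, then a = wc a
-- and b = - wc b with w = ±1, and as Re (wc) cannot be close to both 1 and -1,
-- one of the slices vanishes.

module Submission where

open import Defs
open import Data.Fin.Base using (Fin; zero; suc)
open import Data.Fin.Patterns using (0F; 1F)
open import Data.List.Membership.Propositional using (_∈_)
open import Data.List.Relation.Unary.Any using (here; there)
open import Data.Nat.Base using (ℕ; zero; suc; _≥_; _⊔_)
import Data.Nat.Properties as ℕ
open import Data.Product.Base using (_×_; _,_; proj₁; proj₂; ∃-syntax)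
open import Data.Rational.Base as ℚ using (ℚ; 0ℚ; 1ℚ; ½; ∣_∣; positive)
import Data.Rational.Properties as ℚ
open import Data.Rational.Solver using (module +-*-Solver)
open import Data.Sum.Base using (_⊎_; inj₁; inj₂)
open import Data.Vec.Base using ([]; _∷_; insertAt; replicate)
open import Relation.Binary.PropositionalEquality using (_≡_; refl; sym; trans; cong; cong₂; subst; module ≡-Reasoning)

open +-*-Solver using (solve; _:=_; _:+_; _:*_; _:-_; :-_; con)

-- Null sequences and lower bounds in `ℚ`.

-- `x ≃ y` unfolds to `Null` of the difference sequence, so closure properties of null sequences
-- apply directly to equality of reals.
Null : (ℕ → ℚ) → Set
Null s = ∀ ε → 0ℚ ℚ.< ε → ∃[ N ] (∀ n → n ≥ N → ∣ s n ∣ ℚ.< ε)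

null-resp : ∀ {s t} → (∀ n → s n ≡ t n) → Null s → Null t
null-resp s≡t s-null ε ε>0 =
  let N , h = s-null ε ε>0
  in N , λ n n≥N → subst (λ q → ∣ q ∣ ℚ.< ε) (s≡t n) (h n n≥N)

null-0 : Null (λ _ → 0ℚ)
null-0 ε ε>0 = 0 , λ _ _ → ε>0

null-+ : ∀ {s t} → Null s → Null t → Null (λ n → s n ℚ.+ t n)
null-+ {s} {t} s-null t-null ε ε>0 =
  let
    N₁ , h₁ = s-null (½ ℚ.* ε) (half-pos ε>0)
    N₂ , h₂ = t-null (½ ℚ.* ε) (half-pos ε>0)
  in N₁ ⊔ N₂ , λ n n≥N → begin-strict
    ∣ s n ℚ.+ t n ∣
      ≤⟨ ℚ.∣p+q∣≤∣p∣+∣q∣ (s n) (t n) ⟩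
    ∣ s n ∣ ℚ.+ ∣ t n ∣
      <⟨ ℚ.+-mono-< (h₁ n (m⊔n≤o⇒m≤o n≥N)) (h₂ n (m⊔n≤o⇒n≤o {N₁} n≥N)) ⟩
    ½ ℚ.* ε ℚ.+ ½ ℚ.* ε
      ≡⟨ halves ε ⟩
    ε ∎
  where open ℚ.≤-Reasoning

null-* : ∀ x {s} → Null s → Null (λ n → seq x n ℚ.* s n)
null-* (x , x-cauchy) s-null ε ε>0 =
  let
    B , B>0 , N₁ , x≤B = eventually-bounded {x} x-cauchy
    δ , δ>0 , B*δ≡ε = divide B>0 ε>0
    N₂ , s<δ = s-null δ δ>0
  in N₁ ⊔ N₂ , λ n n≥N →
    below B δ B>0 B*δ≡ε (x≤B n (m⊔n≤o⇒m≤o n≥N)) (s<δ n (m⊔n≤o⇒n≤o {N₁} n≥N))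
  where
  below : ∀ {p q} B δ → 0ℚ ℚ.< B → B ℚ.* δ ≡ ε → ∣ p ∣ ℚ.≤ B → ∣ q ∣ ℚ.< δ →
          ∣ p ℚ.* q ∣ ℚ.< ε
  below {p} {q} B δ B>0 B*δ≡ε p≤B q<δ =
    subst (∣ p ℚ.* q ∣ ℚ.<_) B*δ≡ε (∣p*q∣<B*δ {p} {q} B>0 p≤B q<δ)

-- Division by `x` enlarges errors by a factor of at most 1/δ, so asking for precision `δ * ε` in
-- the product suffices.
null-cancel : ∀ {x s : ℕ → ℚ} {δ} → 0ℚ ℚ.< δ → ∃[ N ] (∀ n → n ≥ N → δ ℚ.≤ x n) →
  Null (λ n → x n ℚ.* s n) → Null s
null-cancel {x} {s} {δ} δ>0 (N₁ , δ≤x) xs-null ε ε>0 =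
  let N₂ , h = xs-null (δ ℚ.* ε) δ*ε>0
  in N₁ ⊔ N₂ , λ n n≥N →
    cancel (x n) (s n) (δ≤x n (m⊔n≤o⇒m≤o n≥N)) (h n (m⊔n≤o⇒n≤o {N₁} n≥N))
  where
  open ℚ.≤-Reasoning

  δ*ε>0 : 0ℚ ℚ.< δ ℚ.* ε
  δ*ε>0 = subst (ℚ._< δ ℚ.* ε) (ℚ.*-zeroʳ δ) (ℚ.*-monoʳ-<-pos δ {{positive δ>0}} ε>0)

  cancel : ∀ p q → δ ℚ.≤ p → ∣ p ℚ.* q ∣ ℚ.< δ ℚ.* ε → ∣ q ∣ ℚ.< ε
  cancel p q δ≤p pq<δε =
    ℚ.*-cancelˡ-<-nonNeg δ {{ℚ.nonNegative (ℚ.<⇒≤ δ>0)}} (begin-strict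
      δ ℚ.* ∣ q ∣
        ≤⟨ ℚ.*-monoʳ-≤-nonNeg ∣ q ∣ {{ℚ.nonNegative (ℚ.0≤∣p∣ q)}} δ≤p ⟩
      p ℚ.* ∣ q ∣
        ≡⟨ cong (ℚ._* ∣ q ∣) (ℚ.0≤p⇒∣p∣≡p (ℚ.≤-trans (ℚ.<⇒≤ δ>0) δ≤p)) ⟨
      ∣ p ∣ ℚ.* ∣ q ∣
        ≡⟨ ℚ.∣p*q∣≡∣p∣*∣q∣ p q ⟨
      ∣ p ℚ.* q ∣
        <⟨ pq<δε ⟩
      δ ℚ.* ε ∎)

-- Constructively the sign of a real is undecidable, but one rational
-- approximation shows which of 1 + x and 1 - x stays away from 0.
1±x-apart : ∀ x →
  ∃[ N ] (∀ n → n ≥ N → ½ ℚ.≤ 1ℚ ℚ.+ seq x n) ⊎ ∃[ N ] (∀ n → n ≥ N → ½ ℚ.≤ 1ℚ ℚ.- seq x n)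
-- With tolerance ½, a nonnegative `x N` keeps later terms above -½, and a nonpositive one keeps
-- them below ½.
1±x-apart (x , x-cauchy) = go (x-cauchy ½ (ℚ.positive⁻¹ ½))
  where
  open ℚ.≤-Reasoning

  p≤∣p∣ : ∀ p → p ℚ.≤ ∣ p ∣
  p≤∣p∣ p with ℚ.≤-total 0ℚ p
  ... | inj₁ 0≤p = ℚ.≤-reflexive (sym (ℚ.0≤p⇒∣p∣≡p 0≤p))
  ... | inj₂ p≤0 = ℚ.≤-trans p≤0 (ℚ.0≤∣p∣ p)

  away : ∀ p q → 0ℚ ℚ.≤ p → p ℚ.- q ℚ.≤ ½ → ½ ℚ.≤ 1ℚ ℚ.+ q
  away p q 0≤p p-q≤½ = begin
    ½                           ≡⟨ ℚ.+-identityʳ ½ ⟨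
    ½ ℚ.+ 0ℚ                    ≤⟨ ℚ.+-monoʳ-≤ ½ 0≤p ⟩
    ½ ℚ.+ p                     ≡⟨ solve 2 (λ p q → con ½ :+ p := (p :- q) :+ (con ½ :+ q)) refl p q ⟩
    (p ℚ.- q) ℚ.+ (½ ℚ.+ q)     ≤⟨ ℚ.+-monoˡ-≤ (½ ℚ.+ q) p-q≤½ ⟩
    ½ ℚ.+ (½ ℚ.+ q)             ≡⟨ ℚ.+-assoc ½ ½ q ⟨
    1ℚ ℚ.+ q ∎

  go : ∃[ N ] (∀ m n → m ≥ N → n ≥ N → ∣ x m ℚ.- x n ∣ ℚ.< ½) →
       ∃[ N ] (∀ n → n ≥ N → ½ ℚ.≤ 1ℚ ℚ.+ x n) ⊎ ∃[ N ] (∀ n → n ≥ N → ½ ℚ.≤ 1ℚ ℚ.- x n)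
  go (N , h) with ℚ.≤-total 0ℚ (x N)
  ... | inj₁ 0≤xN = inj₁ (N , λ n n≥N → away (x N) (x n) 0≤xN
          (ℚ.≤-trans (p≤∣p∣ (x N ℚ.- x n)) (ℚ.<⇒≤ (h N n ℕ.≤-refl n≥N))))
  ... | inj₂ xN≤0 = inj₂ (N , λ n n≥N → away (ℚ.- x N) (ℚ.- x n) (ℚ.neg-antimono-≤ xN≤0)
          (ℚ.≤-trans (ℚ.≤-reflexive (flip (x N) (x n)))
            (ℚ.≤-trans (p≤∣p∣ (x n ℚ.- x N)) (ℚ.<⇒≤ (h n N n≥N ℕ.≤-refl)))))
    where
    flip : ∀ p q → ℚ.- p ℚ.- ℚ.- q ≡ q ℚ.- p
    flip = solve 2 (λ p q → :- p :- :- q := q :- p) refl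

-- Bounds the squared modulus of a complex number from its real part alone; this is what lets such a
-- factor be cancelled.
¼≤p²+q² : ∀ {p} q → ½ ℚ.≤ p → ½ ℚ.* ½ ℚ.≤ p ℚ.* p ℚ.+ q ℚ.* q
¼≤p²+q² {p} q ½≤p = begin
  ½ ℚ.* ½                    ≤⟨ ℚ.*-monoˡ-≤-nonNeg ½ ½≤p ⟩
  ½ ℚ.* p                    ≤⟨ ℚ.*-monoʳ-≤-nonNeg p {{ℚ.nonNegative 0≤p}} ½≤p ⟩
  p ℚ.* p                    ≡⟨ ℚ.+-identityʳ (p ℚ.* p) ⟨
  p ℚ.* p ℚ.+ 0ℚ             ≡⟨ cong (p ℚ.* p ℚ.+_) (ℚ.*-zeroʳ ∣ q ∣) ⟨
  p ℚ.* p ℚ.+ ∣ q ∣ ℚ.* 0ℚ   ≤⟨ ℚ.+-monoʳ-≤ (p ℚ.* p)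
                                  (ℚ.*-monoˡ-≤-nonNeg ∣ q ∣ {{ℚ.nonNegative (ℚ.0≤∣p∣ q)}} (ℚ.0≤∣p∣ q)) ⟩
  p ℚ.* p ℚ.+ ∣ q ∣ ℚ.* ∣ q ∣ ≡⟨ cong (p ℚ.* p ℚ.+_) ∣q∣²≡q² ⟩
  p ℚ.* p ℚ.+ q ℚ.* q        ∎
  where
  open ℚ.≤-Reasoning

  0≤p : 0ℚ ℚ.≤ p
  0≤p = ℚ.≤-trans (ℚ.<⇒≤ (ℚ.positive⁻¹ ½)) ½≤p

  ∣q∣²≡q² : ∣ q ∣ ℚ.* ∣ q ∣ ≡ q ℚ.* q
  ∣q∣²≡q² with ℚ.∣p∣≡p∨∣p∣≡-p q
  ... | inj₁ eq = cong₂ ℚ._*_ eq eq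
  ... | inj₂ eq = trans (cong₂ ℚ._*_ eq eq) (solve 1 (λ q → :- q :* :- q := q :* q) refl q)

-- Gaussian rationals.

ℚ[i] : Set
ℚ[i] = ℚ × ℚ

infixl 6 _⊕_
infixl 7 _⊛_

-- The formulas mirror those of `_+_` and `_*_` on `ℂ`, so sampling at an index commutes with both
-- by computation.
_⊕_ _⊛_ : ℚ[i] → ℚ[i] → ℚ[i]
(a , b) ⊕ (c , d) = a ℚ.+ c , b ℚ.+ d
(a , b) ⊛ (c , d) = a ℚ.* c ℚ.- b ℚ.* d , a ℚ.* d ℚ.+ b ℚ.* c

0ᵢ 1ᵢ : ℚ[i]
0ᵢ = 0ℚ , 0ℚ
1ᵢ = 1ℚ , 0ℚ

⊕-identityˡ : ∀ x → 0ᵢ ⊕ x ≡ x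
⊕-identityˡ (a , b) = cong₂ _,_ (ℚ.+-identityˡ a) (ℚ.+-identityˡ b)

⊕-identityʳ : ∀ x → x ⊕ 0ᵢ ≡ x
⊕-identityʳ (a , b) = cong₂ _,_ (ℚ.+-identityʳ a) (ℚ.+-identityʳ b)

⊛-identityˡ : ∀ x → 1ᵢ ⊛ x ≡ x
⊛-identityˡ (a , b) = cong₂ _,_
  (solve 2 (λ a b → con 1ℚ :* a :- con 0ℚ :* b := a) refl a b)
  (solve 2 (λ a b → con 1ℚ :* b :+ con 0ℚ :* a := b) refl a b)

⊛-zeroˡ : ∀ x → 0ᵢ ⊛ x ≡ 0ᵢ
⊛-zeroˡ (a , b) = cong₂ _,_
  (solve 2 (λ a b → con 0ℚ :* a :- con 0ℚ :* b := con 0ℚ) refl a b)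
  (solve 2 (λ a b → con 0ℚ :* b :+ con 0ℚ :* a := con 0ℚ) refl a b)

⊛-comm : ∀ x y → x ⊛ y ≡ y ⊛ x
⊛-comm (a , b) (c , d) = cong₂ _,_
  (solve 4 (λ a b c d → a :* c :- b :* d := c :* a :- d :* b) refl a b c d)
  (solve 4 (λ a b c d → a :* d :+ b :* c := c :* b :+ d :* a) refl a b c d)

⊛-assoc : ∀ x y z → x ⊛ y ⊛ z ≡ x ⊛ (y ⊛ z)
⊛-assoc (a , b) (c , d) (e , f) = cong₂ _,_
  (solve 6 (λ a b c d e f → (a :* c :- b :* d) :* e :- (a :* d :+ b :* c) :* f :=
                            a :* (c :* e :- d :* f) :- b :* (c :* f :+ d :* e)) refl a b c d e f)
  (solve 6 (λ a b c d e f → (a :* c :- b :* d) :* f :+ (a :* d :+ b :* c) :* e :=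
                            a :* (c :* f :+ d :* e) :+ b :* (c :* e :- d :* f)) refl a b c d e f)

⊛-distribˡ-⊕ : ∀ x y z → x ⊛ (y ⊕ z) ≡ x ⊛ y ⊕ x ⊛ z
⊛-distribˡ-⊕ (a , b) (c , d) (e , f) = cong₂ _,_
  (solve 6 (λ a b c d e f → a :* (c :+ e) :- b :* (d :+ f) :=
                            (a :* c :- b :* d) :+ (a :* e :- b :* f)) refl a b c d e f)
  (solve 6 (λ a b c d e f → a :* (d :+ f) :+ b :* (c :+ e) :=
                            (a :* d :+ b :* c) :+ (a :* f :+ b :* e)) refl a b c d e f)

-- Sums over bit strings and the action of `U at k`.

∑ᵢ : ∀ {n} → (Bits n → ℚ[i]) → ℚ[i]
∑ᵢ {zero}  f = f []
∑ᵢ {suc n} f = ∑ᵢ (λ x → f (0F ∷ x)) ⊕ ∑ᵢ (λ x → f (1F ∷ x))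

∑ᵢ-cong : ∀ {n} {f g : Bits n → ℚ[i]} → (∀ y → f y ≡ g y) → ∑ᵢ f ≡ ∑ᵢ g
∑ᵢ-cong {zero}  f≡g = f≡g []
∑ᵢ-cong {suc n} f≡g = cong₂ _⊕_ (∑ᵢ-cong (λ y → f≡g (0F ∷ y))) (∑ᵢ-cong (λ y → f≡g (1F ∷ y)))

∑ᵢ-0 : ∀ {n} {f : Bits n → ℚ[i]} → (∀ y → f y ≡ 0ᵢ) → ∑ᵢ f ≡ 0ᵢ
∑ᵢ-0 {zero}  f≡0 = f≡0 []
∑ᵢ-0 {suc n} f≡0 = trans
  (cong₂ _⊕_ (∑ᵢ-0 (λ y → f≡0 (0F ∷ y))) (∑ᵢ-0 (λ y → f≡0 (1F ∷ y)))) (⊕-identityˡ 0ᵢ)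

-- All arithmetic on ℂ acts index by index on the approximating sequences, so
-- algebraic identities hold exactly in ℚ[i] at every index.
sample : ℕ → ℂ → ℚ[i]
sample m z = seq (re z) m , seq (im z) m

sample-∑ : ∀ m {n} (f : Bits n → ℂ) → sample m (∑ f) ≡ ∑ᵢ (λ y → sample m (f y))
sample-∑ m {zero}  f = refl
sample-∑ m {suc n} f =
  cong₂ _⊕_ (sample-∑ m (λ y → f (0F ∷ y))) (sample-∑ m (λ y → f (1F ∷ y)))

I-apply : ∀ m j (f : Fin 2 → ℚ[i]) →
  sample m (I j 0F) ⊛ f 0F ⊕ sample m (I j 1F) ⊛ f 1F ≡ f j
I-apply m 0F f = trans (cong₂ _⊕_ (⊛-identityˡ (f 0F)) (⊛-zeroˡ (f 1F))) (⊕-identityʳ (f 0F))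
I-apply m 1F f = trans (cong₂ _⊕_ (⊛-zeroˡ (f 0F)) (⊛-identityˡ (f 1F))) (⊕-identityˡ (f 1F))

-- Peels a leading identity factor off a tensor product: row `j` of `I` is an indicator, so only the
-- half of the sum with first bit `j` survives. The weights `a` stand for entries of the remaining
-- factors.
∑ᵢ-I : ∀ m {n} j (a : Bits n → ℚ[i]) (f : Bits (suc n) → ℚ[i]) →
  ∑ᵢ (λ y → sample m (I j 0F) ⊛ a y ⊛ f (0F ∷ y)) ⊕ ∑ᵢ (λ y → sample m (I j 1F) ⊛ a y ⊛ f (1F ∷ y)) ≡
  ∑ᵢ (λ y → a y ⊛ f (j ∷ y))
∑ᵢ-I m {n} j a f = go j
  where
  keep : ∀ b → ∑ᵢ (λ y → 1ᵢ ⊛ a y ⊛ f (b ∷ y)) ≡ ∑ᵢ (λ y → a y ⊛ f (b ∷ y))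
  keep b = ∑ᵢ-cong (λ y → cong (_⊛ f (b ∷ y)) (⊛-identityˡ (a y)))

  drop : ∀ b → ∑ᵢ (λ y → 0ᵢ ⊛ a y ⊛ f (b ∷ y)) ≡ 0ᵢ
  drop b = ∑ᵢ-0 (λ y → trans (cong (_⊛ f (b ∷ y)) (⊛-zeroˡ (a y))) (⊛-zeroˡ (f (b ∷ y))))

  go : ∀ j → ∑ᵢ (λ y → sample m (I j 0F) ⊛ a y ⊛ f (0F ∷ y)) ⊕
             ∑ᵢ (λ y → sample m (I j 1F) ⊛ a y ⊛ f (1F ∷ y)) ≡ ∑ᵢ (λ y → a y ⊛ f (j ∷ y))
  go 0F = trans (cong₂ _⊕_ (keep 0F) (drop 1F)) (⊕-identityʳ _)
  go 1F = trans (cong₂ _⊕_ (drop 0F) (keep 1F)) (⊕-identityˡ _)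

⨂I-apply : ∀ m {n} (v : Bits n → ℚ[i]) x →
  ∑ᵢ (λ y → sample m (⨂ (replicate n I) x y) ⊛ v y) ≡ v x
⨂I-apply m v []              = ⊛-identityˡ (v [])
⨂I-apply m {suc n} v (i ∷ x) =
  trans (∑ᵢ-I m i (λ y → sample m (⨂ (replicate n I) x y)) v) (⨂I-apply m (λ y → v (i ∷ y)) x)

-- Induction on `k`: identities in front of `U` are peeled off one by one, each dropping the first
-- bit of the row index; once `U` leads, the identities behind it act trivially.
at-applyᵢ : ∀ m {n} U (k : Fin (suc n)) (v : Bits (suc n) → ℚ[i]) i x →
  ∑ᵢ (λ y → sample m ((U at k) (insertAt x k i) y) ⊛ v y) ≡
  sample m (U i 0F) ⊛ v (insertAt x k 0F) ⊕ sample m (U i 1F) ⊛ v (insertAt x k 1F)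
at-applyᵢ m {n} U zero v i x = cong₂ _⊕_ (half 0F) (half 1F)
  where
  swap : ∀ a b c → a ⊛ b ⊛ c ≡ b ⊛ (a ⊛ c)
  swap a b c = trans (cong (_⊛ c) (⊛-comm a b)) (⊛-assoc b a c)

  half : ∀ j → ∑ᵢ (λ y → sample m (U i j) ⊛ sample m (⨂ (replicate n I) x y) ⊛ v (j ∷ y)) ≡
               sample m (U i j) ⊛ v (j ∷ x)
  half j = trans
    -- The entry of `U` does not depend on `y`, so it is absorbed into the vector on which the
    -- identities act.
    (∑ᵢ-cong (λ y → swap (sample m (U i j)) (sample m (⨂ (replicate n I) x y)) (v (j ∷ y))))
    (⨂I-apply m (λ y → sample m (U i j) ⊛ v (j ∷ y)) x)
at-applyᵢ m U (suc k) v i (j ∷ x) = trans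
  (∑ᵢ-I m j (λ y → sample m ((U at k) (insertAt x k i) y)) v)
  (at-applyᵢ m U k (λ y → v (j ∷ y)) i x)

-- Unlike _≈_, which unfolds to a statement about sequences only, this record
-- lets Agda recover the two complex numbers.
infix 4 _≐_

record _≐_ (z w : ℂ) : Set where
  constructor exactly
  field sample-≡ : ∀ m → sample m z ≡ sample m w

open _≐_

≈-resp-≐ : ∀ {x x′ y y′} → x ≐ x′ → y ≐ y′ → x ≈ y → x′ ≈ y′
≈-resp-≐ p q (re≃ , im≃) =
  null-resp (λ m → cong₂ (λ a b → proj₁ a ℚ.- proj₁ b) (p .sample-≡ m) (q .sample-≡ m)) re≃ ,
  null-resp (λ m → cong₂ (λ a b → proj₂ a ℚ.- proj₂ b) (p .sample-≡ m) (q .sample-≡ m)) im≃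

≐-refl : ∀ {z} → z ≐ z
≐-refl .sample-≡ m = refl

≐⇒≈ : ∀ {z w} → z ≐ w → z ≈ w
≐⇒≈ {z} z≐w = ≈-resp-≐ {z} ≐-refl z≐w
  ( null-resp (λ m → sym (ℚ.+-inverseʳ (seq (re z) m))) null-0
  , null-resp (λ m → sym (ℚ.+-inverseʳ (seq (im z) m))) null-0 )

at-apply : ∀ {n} U (k : Fin (suc n)) (v : Vector (Bits (suc n))) i x →
  (U at k $$ v) (insertAt x k i) ≐ U i 0F * v (insertAt x k 0F) + U i 1F * v (insertAt x k 1F)
at-apply U k v i x .sample-≡ m = trans
  (sample-∑ m (λ y → (U at k) (insertAt x k i) y * v y))
  (at-applyᵢ m U k (λ y → sample m (v y)) i x)

-- Congruence and cancellation in `ℂ` up to null sequences.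

*-congˡ : ∀ z {x y} → x ≈ y → z * x ≈ z * y
*-congˡ z {x} {y} (re≃ , im≃) =
  null-resp (λ n → re-eq (a n) (b n) (seq (re x) n) (seq (im x) n) (seq (re y) n) (seq (im y) n))
    (null-+ (null-* (re z) re≃) (null-* (-ℝ im z) im≃)) ,
  null-resp (λ n → im-eq (a n) (b n) (seq (re x) n) (seq (im x) n) (seq (re y) n) (seq (im y) n))
    (null-+ (null-* (re z) im≃) (null-* (im z) re≃))
  where
  a b : ℕ → ℚ
  a = seq (re z)
  b = seq (im z)

  re-eq : ∀ a b x₁ x₂ y₁ y₂ → a ℚ.* (x₁ ℚ.- y₁) ℚ.+ (ℚ.- b) ℚ.* (x₂ ℚ.- y₂) ≡
          (a ℚ.* x₁ ℚ.- b ℚ.* x₂) ℚ.- (a ℚ.* y₁ ℚ.- b ℚ.* y₂)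
  re-eq = solve 6 (λ a b x₁ x₂ y₁ y₂ → a :* (x₁ :- y₁) :+ (:- b) :* (x₂ :- y₂) :=
          (a :* x₁ :- b :* x₂) :- (a :* y₁ :- b :* y₂)) refl

  im-eq : ∀ a b x₁ x₂ y₁ y₂ → a ℚ.* (x₂ ℚ.- y₂) ℚ.+ b ℚ.* (x₁ ℚ.- y₁) ≡
          (a ℚ.* x₂ ℚ.+ b ℚ.* x₁) ℚ.- (a ℚ.* y₂ ℚ.+ b ℚ.* y₁)
  im-eq = solve 6 (λ a b x₁ x₂ y₁ y₂ → a :* (x₂ :- y₂) :+ b :* (x₁ :- y₁) :=
          (a :* x₂ :+ b :* x₁) :- (a :* y₂ :+ b :* y₁)) refl

≈⇒-≈0 : ∀ {x y} → x ≈ y → x + - y ≈ 0ℂ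
≈⇒-≈0 (re≃ , im≃) =
  null-resp (λ n → sym (ℚ.+-identityʳ _)) re≃ ,
  null-resp (λ n → sym (ℚ.+-identityʳ _)) im≃

-- Multiplying by the conjugate of w turns the coefficient into |w|² ≥ ¼.
*-cancel-≈0 : ∀ w z → ∃[ N ] (∀ n → n ≥ N → ½ ℚ.≤ seq (re w) n) → w * z ≈ 0ℂ → z ≈ 0ℂ
*-cancel-≈0 w z (N , ½≤re) wz≈0 = cancel re-eq (proj₁ scaled) , cancel im-eq (proj₂ scaled)
  where
  w̄ : ℂ
  w̄ = re w +i (-ℝ im w)

  scaled : w̄ * (w * z) ≈ w̄ * 0ℂ
  scaled = *-congˡ w̄ {w * z} {0ℂ} wz≈0

  cancel : ∀ {s t : ℕ → ℚ} →
    (∀ n → s n ≡ (seq (re w) n ℚ.* seq (re w) n ℚ.+ seq (im w) n ℚ.* seq (im w) n) ℚ.* t n) →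
    Null s → Null t
  cancel {t = t} eq s-null = null-cancel (ℚ.positive⁻¹ (½ ℚ.* ½))
    (N , λ n n≥N → ¼≤p²+q² (seq (im w) n) (½≤re n n≥N)) (null-resp eq s-null)

  re-eq : ∀ n → _
  re-eq n = solve 4 (λ a b x y →
    (a :* (a :* x :- b :* y) :- (:- b) :* (a :* y :+ b :* x)) :- (a :* con 0ℚ :- (:- b) :* con 0ℚ) :=
    (a :* a :+ b :* b) :* (x :- con 0ℚ)) refl
    (seq (re w) n) (seq (im w) n) (seq (re z) n) (seq (im z) n)

  im-eq : ∀ n → _
  im-eq n = solve 4 (λ a b x y →
    (a :* (a :* y :+ b :* x) :+ (:- b) :* (a :* x :- b :* y)) :- (a :* con 0ℚ :+ (:- b) :* con 0ℚ) :=
    (a :* a :+ b :* b) :* (y :- con 0ℚ)) refl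
    (seq (re w) n) (seq (im w) n) (seq (re z) n) (seq (im z) n)

-- The equation reads (1 - d) z = 0, and the real part of 1 - d is eventually at least ½, so this
-- factor cancels.
fixed-≈0 : ∀ d z → ∃[ N ] (∀ n → n ≥ N → ½ ℚ.≤ 1ℚ ℚ.- seq (re d) n) → z ≈ d * z → z ≈ 0ℂ
fixed-≈0 d z away z≈dz = *-cancel-≈0 (1ℂ + - d) z away
  (≈-resp-≐ {z + - (d * z)} {(1ℂ + - d) * z} {0ℂ} (exactly λ m → eq (sample m d) (sample m z)) ≐-refl
    (≈⇒-≈0 {z} {d * z} z≈dz))
  where
  eq : ∀ ((a , b) (x , y) : ℚ[i]) →
    (x ℚ.- (a ℚ.* x ℚ.- b ℚ.* y) , y ℚ.- (a ℚ.* y ℚ.+ b ℚ.* x)) ≡ (1ℚ ℚ.- a , 0ℚ ℚ.- b) ⊛ (x , y)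
  eq (a , b) (x , y) = cong₂ _,_
    (solve 4 (λ a b x y → x :- (a :* x :- b :* y) :=
                          (con 1ℚ :- a) :* x :- (con 0ℚ :- b) :* y) refl a b x y)
    (solve 4 (λ a b x y → y :- (a :* y :+ b :* x) :=
                          (con 1ℚ :- a) :* y :+ (con 0ℚ :- b) :* x) refl a b x y)

-- Slices of an eigenvector.

module _ {n : ℕ} (k : Fin (suc n)) (U : Operator (Fin 2)) (φ : State (suc n))
         (c : ℂ) (eigen : U at k $$ vector φ ≋ c · vector φ) where

  private
    slice : Fin 2 → Bits n → ℂ
    slice b x = vector φ (insertAt x k b)

  -- Scaling row `i` of the eigenvalue equation by `w` turns row `i` of `U` into row `j` of the
  -- identity, which picks out slice `j`. Antidiagonal `U` uses (i, j) = (0, 1); diagonal `U` uses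
  -- (0, 0) and (1, 1) with opposite scalars.
  row-multiple : ∀ w i j → (∀ b m → sample m (w * U i b) ≡ sample m (I j b)) →
    ∀ x → slice j x ≈ w * c * slice i x
  row-multiple w i j wU≡I x =
    ≈-resp-≐ {w * (U at k $$ vector φ) (insertAt x k i)} {slice j x}
             {w * (c * slice i x)} {w * c * slice i x}
      (exactly left) (exactly λ m → sym (⊛-assoc (sample m w) (sample m c) (sample m (slice i x))))
      (*-congˡ w {(U at k $$ vector φ) (insertAt x k i)} {c * slice i x} (eigen (insertAt x k i)))
    where
    open ≡-Reasoning

    left : ∀ m → sample m w ⊛ sample m ((U at k $$ vector φ) (insertAt x k i)) ≡ sample m (slice j x)
    left m = begin
      W ⊛ sample m ((U at k $$ vector φ) (insertAt x k i))
        ≡⟨ cong (W ⊛_) (at-apply U k (vector φ) i x .sample-≡ m) ⟩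
      W ⊛ (u 0F ⊛ s 0F ⊕ u 1F ⊛ s 1F)
        ≡⟨ ⊛-distribˡ-⊕ W (u 0F ⊛ s 0F) (u 1F ⊛ s 1F) ⟩
      W ⊛ (u 0F ⊛ s 0F) ⊕ W ⊛ (u 1F ⊛ s 1F)
        ≡⟨ cong₂ _⊕_ (⊛-assoc W (u 0F) (s 0F)) (⊛-assoc W (u 1F) (s 1F)) ⟨
      W ⊛ u 0F ⊛ s 0F ⊕ W ⊛ u 1F ⊛ s 1F
        ≡⟨ cong₂ (λ p q → p ⊛ s 0F ⊕ q ⊛ s 1F) (wU≡I 0F m) (wU≡I 1F m) ⟩
      sample m (I j 0F) ⊛ s 0F ⊕ sample m (I j 1F) ⊛ s 1F
        ≡⟨ I-apply m j s ⟩
      s j ∎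
      where
      W = sample m w
      u = λ b → sample m (U i b)
      s = λ b → sample m (slice b x)

  private
    -- `toFront` evaluated at `(b , x)` is `slice b x`, so the reference slice `j` serves as the
    -- second tensor factor and `u` collects the ratios.
    proportional : ∀ u j → (∀ b x → slice b x ≈ u b * slice j x) → Unentangled k φ
    proportional u j h = u , slice j , λ (b , x) → h b x

    ≈1* : ∀ z → z ≈ 1ℂ * z
    ≈1* z = ≐⇒≈ {z} {1ℂ * z} (exactly λ m → sym (⊛-identityˡ (sample m z)))

    ≈0⇒≈0* : ∀ {z} w → z ≈ 0ℂ → z ≈ 0ℂ * w
    ≈0⇒≈0* {z} w = ≈-resp-≐ {z} {z} {0ℂ} {0ℂ * w} ≐-refl (exactly λ m → sym (⊛-zeroˡ (sample m w)))

  antidiagonal : ∀ w → (∀ b m → sample m (w * U 0F b) ≡ sample m (I 1F b)) → Unentangled k φ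
  antidiagonal w wU≡I = proportional (λ { 0F → 1ℂ ; 1F → w * c }) 0F λ where
    0F x → ≈1* (slice 0F x)
    1F x → row-multiple w 0F 1F wU≡I x

  private
    -- Converts the lower bound on 1 + Re (wc) into the form that `fixed-≈0` expects for the factor
    -- -wc.
    1+x≡1-[-x] : ∀ w m → 1ℚ ℚ.+ seq (re (w * c)) m ≡ 1ℚ ℚ.- seq (re (- w * c)) m
    1+x≡1-[-x] w m = solve 4
      (λ a b c d → con 1ℚ :+ (a :* c :- b :* d) := con 1ℚ :- ((:- a) :* c :- (:- b) :* d)) refl
      (seq (re w) m) (seq (im w) m) (seq (re c) m) (seq (im c) m)

  -- A lower bound on 1 + Re (wc) forces slice 1 to vanish, and one on 1 - Re (wc) forces slice 0 to
  -- vanish; the other slice becomes the second tensor factor, with a basis vector as the first.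
  diagonal : ∀ w → (∀ b m → sample m (w * U 0F b) ≡ sample m (I 0F b)) →
    (∀ b m → sample m (- w * U 1F b) ≡ sample m (I 1F b)) → Unentangled k φ
  diagonal w wU≡I -wU≡I = go (1±x-apart (re (w * c)))
    where
    go : ∃[ N ] (∀ m → m ≥ N → ½ ℚ.≤ 1ℚ ℚ.+ seq (re (w * c)) m) ⊎
         ∃[ N ] (∀ m → m ≥ N → ½ ℚ.≤ 1ℚ ℚ.- seq (re (w * c)) m) → Unentangled k φ
    go (inj₁ (N , ½≤1+x)) = proportional (λ { 0F → 1ℂ ; 1F → 0ℂ }) 0F λ where
      0F x → ≈1* (slice 0F x)
      1F x → ≈0⇒≈0* {slice 1F x} (slice 0F x)
        (fixed-≈0 (- w * c) (slice 1F x) (N , λ m m≥N → subst (½ ℚ.≤_) (1+x≡1-[-x] w m) (½≤1+x m m≥N))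
          (row-multiple (- w) 1F 1F -wU≡I x))
    go (inj₂ away) = proportional (λ { 0F → 0ℂ ; 1F → 1ℂ }) 1F λ where
      0F x → ≈0⇒≈0* {slice 0F x} (slice 1F x)
        (fixed-≈0 (w * c) (slice 0F x) away (row-multiple w 0F 0F wU≡I x))
      1F x → ≈1* (slice 1F x)

corollary1 : (n : ℕ) (k : Fin (suc n)) (U : Operator (Fin 2)) → U ∈ ±Paulis →
    (φ : State (suc n)) → HasType (U at k) φ → Unentangled k φ
corollary1 n k U (here refl) φ (c , eigen) =
  -- In all six cases the scalar passed is the inverse of the nonzero entry in row 0 of `U`; the row
  -- conditions then hold by evaluating closed rationals.
  antidiagonal k U φ c eigen 1ℂ λ { 0F _ → refl ; 1F _ → refl }
corollary1 n k U (there (here refl)) φ (c , eigen) =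
  antidiagonal k U φ c eigen (- 1ℂ) λ { 0F _ → refl ; 1F _ → refl }
corollary1 n k U (there (there (here refl))) φ (c , eigen) =
  antidiagonal k U φ c eigen iℂ λ { 0F _ → refl ; 1F _ → refl }
corollary1 n k U (there (there (there (here refl)))) φ (c , eigen) =
  antidiagonal k U φ c eigen (- iℂ) λ { 0F _ → refl ; 1F _ → refl }
corollary1 n k U (there (there (there (there (here refl))))) φ (c , eigen) =
  diagonal k U φ c eigen 1ℂ
    (λ { 0F _ → refl ; 1F _ → refl })
    (λ { 0F _ → refl ; 1F _ → refl })
corollary1 n k U (there (there (there (there (there (here refl)))))) φ (c , eigen) =
  diagonal k U φ c eigen (- 1ℂ)
    (λ { 0F _ → refl ; 1F _ → refl })
    (λ { 0F _ → refl ; 1F _ → refl })
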